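{- For every integer $n\ge 0$, the chromatic polynomial of the matroid $\mathcal M_n$ is $$p_{\mathcal M_n}(t)=(t-1)^n.$$
   Context: $[n]$ denotes the linearly ordered set $\{0<1<\dots<n\}$, with meet $i\wedge j=\min(i,j)$. $[n]^\to$ denotes the set of nontrivial edges of $[n]$, i.e. pairs $(i\to j)$ with $0\le i<j\le n$. A transfer system on $[n]$ is a partial order $T$ on the set $[n]$ that is contained in $\le$ (reflexive, transitive, and $i\,T\,j$ implies $i\le j$) and is closed under restriction: if $i\,T\,j$ and $k\in[n]$, then $(i\wedge k)\,T\,(j\wedge k)$. For every $S\subseteq[n]^\to$ there is a smallest transfer system containing $S$, called the transfer system generated by $S$. A set $S\subseteq [n]^\to$ is a minimal generating set if no proper subset of $S$ generates the same transfer system as $S$; $\mathrm{MGS}([n])\subseteq\mathcal P([n]^\to)$ denotes the collection of all minimal generating sets (of all transfer systems on $[n]$). $\mathcal M_n=([n]^\to,\mathrm{MGS}([n]))$ is the matroid with ground set $[n]^\to$ whose independent sets are the elements of $\mathrm{MGS}([n])$ (it is a fact that this pair is a matroid). For a matroid $(E,I)$ with ground set $E$ and collection of independent sets $I$, the rank $r(S)$ of $S\subseteq E$ is the size of a largest independent subset of $S$, and the chromatic polynomial is $$p_E(t)=\sum_{S\subseteq E}(-1)^{|S|}t^{r(E)-r(S)}.$$ -}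

module Defs where

import Algebra.Construct.NaturalChoice.Min as Min
open import Data.Fin.Base using (Fin; zero; suc; _≤_; _<_)
open import Data.Fin.Properties
  using (≤-refl; ≤-trans; ≤-antisym; ≤-totalOrder; <-cmp; ≤∧≢⇒<; _<?_; _≟_;
         any?; all?; suc-injective)
import Data.Fin.Properties as Fin
open import Data.Fin.Subset
  using (Subset; inside; outside; ⊥; ⊤; _∈_; _∉_; _⊆_; _⊂_; _∪_; _-_; ⁅_⁆; ∣_∣)
open import Data.Fin.Subset.Properties
  using (_∈?_; _⊆?_; ∉⊥; x∈p⇒p-x⊂p; x∈p∧x≢y⇒x∈p-y; x∈p⇒∣p-x∣<∣p∣; x∈p∪q⁻; x∈⁅y⁆⇒x≡y)
open import Data.Integer.Base as ℤ using (ℤ; 0ℤ; 1ℤ; -1ℤ)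
open import Data.List.Base
  using (List; []; _∷_; [_]; _++_; map; foldr; filter; replicate; length; lookup;
         allFin; cartesianProduct)
open import Data.List.Membership.Propositional.Properties
  using (∈-lookup; ∈-filter⁺; ∈-filter⁻; ∈-cartesianProduct⁺; ∈-allFin)
import Data.List.Relation.Unary.All as All
open import Data.List.Relation.Unary.AllPairs using (_∷_)
open import Data.List.Relation.Unary.Any using (index)
open import Data.List.Relation.Unary.Any.Properties using (lookup-index)
open import Data.List.Relation.Unary.Unique.Propositional using (Unique)
import Data.List.Relation.Unary.Unique.Propositional.Properties as Unique
open import Data.Nat.Base as ℕ using (ℕ; zero; suc; _⊔_; _∸_)
import Data.Nat.Properties as ℕ
open import Data.Product.Base using (_×_; _,_; ∃-syntax; proj₁; proj₂)
open import Data.Sum.Base using (inj₁; inj₂)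
open import Data.Vec.Base using ([]; _∷_; here; there)
open import Function.Base using (_∘_)
open import Function.Bundles using (_⇔_; mk⇔; Equivalence)
open import Level using (0ℓ)
open import Relation.Binary.Core using (Rel; _⇒_)
open import Relation.Binary.Definitions using (tri<; tri≈; tri>)
open import Relation.Binary.PropositionalEquality
  using (_≡_; _≢_; refl; sym; trans; cong; cong₂; subst; subst₂; isEquivalence)
open import Relation.Binary.Structures using (IsPartialOrder)
open import Relation.Nullary.Decidable
  using (yes; no; map′; _×-dec_; _→-dec_; ¬?; decidable-stable)
open import Relation.Nullary.Negation using (¬_; contradiction)
open import Relation.Unary using (Decidable)

------------------------------------------------------------------------
-- Polynomials in one variable over ℤ

-- Coefficient lists, constant term first.  Trailing zeros are allowed, so
-- polynomials are compared by _≈ₚ_ and not by _≡_.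
Poly : Set
Poly = List ℤ

coeff : Poly → ℕ → ℤ
coeff []      _       = 0ℤ
coeff (a ∷ p) zero    = a
coeff (a ∷ p) (suc k) = coeff p k

infix 4 _≈ₚ_
_≈ₚ_ : Poly → Poly → Set
p ≈ₚ q = ∀ k → coeff p k ≡ coeff q k

infixl 6 _+ₚ_ _-ₚ_
infixl 7 _*ₚ_
infixr 8 _^ₚ_

_+ₚ_ : Poly → Poly → Poly
[]      +ₚ q       = q
(a ∷ p) +ₚ []      = a ∷ p
(a ∷ p) +ₚ (b ∷ q) = (a ℤ.+ b) ∷ (p +ₚ q)

-ₚ_ : Poly → Poly
-ₚ_ = map (λ a → ℤ.- a)

_-ₚ_ : Poly → Poly → Poly
p -ₚ q = p +ₚ (-ₚ q)

_*ₚ_ : Poly → Poly → Poly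
[]      *ₚ q = []
(a ∷ p) *ₚ q = map (a ℤ.*_) q +ₚ (0ℤ ∷ (p *ₚ q))

const : ℤ → Poly
const a = [ a ]

t : Poly
t = 0ℤ ∷ 1ℤ ∷ []

_^ₚ_ : Poly → ℕ → Poly
p ^ₚ zero  = const 1ℤ
p ^ₚ suc k = p *ₚ (p ^ₚ k)

sumₚ : List Poly → Poly
sumₚ = foldr _+ₚ_ []

------------------------------------------------------------------------
-- Finite matroids

-- All subsets of Fin m, each listed exactly once.
subsets : ∀ m → List (Subset m)
subsets zero    = [ [] ]
subsets (suc m) = map (outside ∷_) (subsets m) ++ map (inside ∷_) (subsets m)

-- Independence is required to be decidable so that the rank can be defined
-- as a function; classically this is no restriction.
record Matroid (m : ℕ) : Set₁ where
  field
    Independent  : Subset m → Set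
    independent? : Decidable Independent
    empty        : Independent ⊥
    hereditary   : ∀ {S T} → S ⊆ T → Independent T → Independent S
    augmentation : ∀ {S T} → Independent S → Independent T → ∣ S ∣ ℕ.< ∣ T ∣ →
                   ∃[ e ] e ∈ T × e ∉ S × Independent (S ∪ ⁅ e ⁆)

module _ {m : ℕ} (M : Matroid m) where
  open Matroid M

  rank : Subset m → ℕ
  rank S = foldr _⊔_ 0
    (map ∣_∣ (filter (λ T → (T ⊆? S) ×-dec independent? T) (subsets m)))

  -- The truncated subtraction is exact, as rank S ≤ rank ⊤.
  chromaticPolynomial : Poly
  chromaticPolynomial = sumₚ
    (map (λ S → const (-1ℤ ℤ.^ ∣ S ∣) *ₚ t ^ₚ (rank ⊤ ∸ rank S)) (subsets m))

------------------------------------------------------------------------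
-- The ground set [n]^→

module _ (n : ℕ) where

  [n] : Set
  [n] = Fin (suc n)

  isEdge? : Decidable {A = [n] × [n]} (λ (i , j) → i < j)
  isEdge? (i , j) = i <? j

  edges : List ([n] × [n])
  edges = filter isEdge? (cartesianProduct (allFin (suc n)) (allFin (suc n)))

  -- Edges are named by their position in the list, so that a subset of the
  -- ground set is a Subset #edges.
  #edges : ℕ
  #edges = length edges

  edge : Fin #edges → [n] × [n]
  edge = lookup edges

  src tgt : Fin #edges → [n]
  src e = proj₁ (edge e)
  tgt e = proj₂ (edge e)

  src<tgt : ∀ (e : Fin #edges) → src e < tgt e
  src<tgt e =
    proj₂ (∈-filter⁻ isEdge? {xs = cartesianProduct (allFin (suc n)) (allFin (suc n))}
            (∈-lookup e))

  edge-surjective : ∀ {i j : [n]} → i < j → ∃[ e ] edge e ≡ (i , j)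
  edge-surjective {i} {j} i<j = index ij∈ , sym (lookup-index ij∈)
    where ij∈ = ∈-filter⁺ isEdge? (∈-cartesianProduct⁺ (∈-allFin i) (∈-allFin j)) i<j

  private
    lookup-injective : ∀ {A : Set} {xs : List A} → Unique xs →
                       ∀ i j → lookup xs i ≡ lookup xs j → i ≡ j
    lookup-injective {xs = _ ∷ _}  (x∉ ∷ u) zero    zero    eq = refl
    lookup-injective {xs = _ ∷ xs} (x∉ ∷ u) zero    (suc j) eq =
      contradiction eq (All.lookup x∉ (∈-lookup j))
    lookup-injective {xs = _ ∷ xs} (x∉ ∷ u) (suc i) zero    eq =
      contradiction (sym eq) (All.lookup x∉ (∈-lookup i))
    lookup-injective {xs = _ ∷ _}  (x∉ ∷ u) (suc i) (suc j) eq =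
      cong suc (lookup-injective u i j eq)

  edge-injective : ∀ {e f} → edge e ≡ edge f → e ≡ f
  edge-injective = lookup-injective
    (Unique.filter⁺ isEdge?
      (Unique.cartesianProduct⁺ (Unique.allFin⁺ (suc n)) (Unique.allFin⁺ (suc n)))) _ _

  ----------------------------------------------------------------------
  -- Transfer systems

  open module Meet = Min (≤-totalOrder (suc n))
    using (x≤y⇒x⊓y≈x; x≤y⇒y⊓x≈x) renaming (_⊓_ to _∧_)

  record IsTransferSystem {ℓ} (T : Rel [n] ℓ) : Set ℓ where
    field
      isPartialOrder : IsPartialOrder _≡_ T
      within-≤       : T ⇒ _≤_
      restriction    : ∀ {i j} k → T i j → T (i ∧ k) (j ∧ k)

  Contains : ∀ {ℓ} → Rel [n] ℓ → Subset #edges → Set ℓ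
  Contains T S = ∀ {e} → e ∈ S → T (src e) (tgt e)

  -- The transfer system generated by S.  That it is a transfer system and the
  -- smallest one containing S is shown right below.
  data Generated (S : Subset #edges) : Rel [n] 0ℓ where
    gen        : Contains (Generated S) S
    reflexive  : ∀ {i} → Generated S i i
    transitive : ∀ {i j k} → Generated S i j → Generated S j k → Generated S i k
    restrict   : ∀ {i j} k → Generated S i j → Generated S (i ∧ k) (j ∧ k)

  private
    ∧-monoˡ : ∀ {i j : [n]} k → i ≤ j → i ∧ k ≤ j ∧ k
    ∧-monoˡ {i = i} {j} k i≤j with Fin.≤-total i k | Fin.≤-total j k
    ... | inj₁ _   | inj₁ _   = i≤j
    ... | inj₁ i≤k | inj₂ _   = i≤k
    ... | inj₂ k≤i | inj₁ _   = ≤-trans k≤i i≤j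
    ... | inj₂ _   | inj₂ _   = ≤-refl

  generated⇒≤ : ∀ {S : Subset #edges} → Generated S ⇒ _≤_
  generated⇒≤ (gen {e} _)      = ℕ.<⇒≤ (src<tgt e)
  generated⇒≤ reflexive        = ≤-refl
  generated⇒≤ (transitive p q) = ≤-trans (generated⇒≤ p) (generated⇒≤ q)
  generated⇒≤ (restrict k p)   = ∧-monoˡ k (generated⇒≤ p)

  generated-isTransferSystem : ∀ (S : Subset #edges) → IsTransferSystem (Generated S)
  generated-isTransferSystem S = record
    { isPartialOrder = record
      { isPreorder = record
        { isEquivalence = isEquivalence
        ; reflexive     = λ { refl → reflexive }
        ; trans         = transitive
        }
      ; antisym = λ p q → ≤-antisym (generated⇒≤ p) (generated⇒≤ q)
      }
    ; within-≤    = generated⇒≤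
    ; restriction = restrict
    }

  generated-least : ∀ {ℓ} {S : Subset #edges} {T : Rel [n] ℓ} →
                    IsTransferSystem T → Contains T S → Generated S ⇒ T
  generated-least {S = S} {T} isT T⊇S = go
    where
    open IsTransferSystem isT
    go : Generated S ⇒ T
    go (gen e∈S)        = T⊇S e∈S
    go reflexive        = IsPartialOrder.refl isPartialOrder
    go (transitive p q) = IsPartialOrder.trans isPartialOrder (go p) (go q)
    go (restrict k p)   = restriction k (go p)

  GenerateSame : Rel (Subset #edges) 0ℓ
  GenerateSame S S′ = ∀ i j → Generated S i j ⇔ Generated S′ i j

  MGS : Subset #edges → Set
  MGS S = ∀ S′ → S′ ⊂ S → ¬ GenerateSame S′ S

  ----------------------------------------------------------------------
  -- Minimal generating sets form a matroid

  -- The matroid axioms and the decidability of MGS go through the following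
  -- description of minimal generating sets.
  DistinctSources : Subset #edges → Set
  DistinctSources S = ∀ e → e ∈ S → ∀ f → f ∈ S → src e ≡ src f → e ≡ f

  private
    ∧<⇒ : ∀ (i j k : [n]) → i ∧ k < j ∧ k → i < j × i ∧ k ≡ i
    ∧<⇒ i j k lt with Fin.≤-total i k | Fin.≤-total j k
    ... | inj₁ _   | inj₁ _   = lt , refl
    ... | inj₁ i≤k | inj₂ k≤j = ℕ.<-≤-trans lt k≤j , refl
    ... | inj₂ k≤i | inj₁ j≤k = contradiction (ℕ.<-≤-trans lt j≤k) (ℕ.<-irrefl refl)
    ... | inj₂ k≤i | inj₂ _   = contradiction lt (ℕ.<-irrefl refl)

    source-of : ∀ {S : Subset #edges} {i j} → Generated S i j → i < j →
                ∃[ e ] e ∈ S × src e ≡ i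
    source-of (gen {e} e∈S) _   = e , e∈S , refl
    source-of reflexive     i<i = contradiction i<i (ℕ.<-irrefl refl)
    source-of (transitive {i} {j} p q) i<k with i ≟ j
    ... | yes refl = source-of q i<k
    ... | no  i≢j  = source-of p (≤∧≢⇒< (generated⇒≤ p) i≢j)
    source-of (restrict {i} {j} k p) lt with ∧<⇒ i j k lt
    ... | i<j , eq with source-of p i<j
    ... | e , e∈S , se = e , e∈S , trans se (sym eq)

    distinct⇒MGS : ∀ {S : Subset #edges} → DistinctSources S → MGS S
    distinct⇒MGS dist S′ (S′⊆S , x , x∈S , x∉S′) same
      with source-of (Equivalence.from (same (src x) (tgt x)) (gen x∈S)) (src<tgt x)
    ... | e , e∈S′ , eq = x∉S′ (subst (_∈ S′) (dist e (S′⊆S e∈S′) x x∈S eq) e∈S′)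

    -- An edge is a restriction of any longer edge with the same source.
    longer-edge : ∀ {S : Subset #edges} → MGS S → ∀ {e f} → e ∈ S → f ∈ S →
                  src e ≡ src f → ¬ (tgt e < tgt f)
    longer-edge {S} mgs {e} {f} e∈S f∈S eq te<tf =
      mgs (S - e) S-e⊂S λ i j → mk⇔
        (generated-least (generated-isTransferSystem S) (gen ∘ proj₁ S-e⊂S))
        (generated-least (generated-isTransferSystem (S - e)) ⊇S)
      where
      S-e⊂S = x∈p⇒p-x⊂p e∈S
      f≢e : f ≢ e
      f≢e refl = ℕ.<-irrefl refl te<tf
      e∈gen : Generated (S - e) (src e) (tgt e)
      e∈gen = subst₂ (Generated (S - e))
        (trans (cong (_∧ tgt e) (sym eq)) (x≤y⇒x⊓y≈x (ℕ.<⇒≤ (src<tgt e))))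
        (x≤y⇒y⊓x≈x (ℕ.<⇒≤ te<tf))
        (restrict (tgt e) (gen (x∈p∧x≢y⇒x∈p-y f∈S f≢e)))
      ⊇S : Contains (Generated (S - e)) S
      ⊇S {g} g∈S with g ≟ e
      ... | yes refl = e∈gen
      ... | no  g≢e  = gen (x∈p∧x≢y⇒x∈p-y g∈S g≢e)

    MGS⇒distinct : ∀ {S : Subset #edges} → MGS S → DistinctSources S
    MGS⇒distinct mgs e e∈S f f∈S eq with <-cmp (tgt e) (tgt f)
    ... | tri< lt _ _ = contradiction lt (longer-edge mgs e∈S f∈S eq)
    ... | tri≈ _ te≡tf _ = edge-injective (cong₂ _,_ eq te≡tf)
    ... | tri> _ _ gt = contradiction gt (longer-edge mgs f∈S e∈S (sym eq))

    MGS? : Decidable MGS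
    MGS? S = map′ distinct⇒MGS MGS⇒distinct
      (all? λ e → (e ∈? S) →-dec (all? λ f →
        (f ∈? S) →-dec ((src e ≟ src f) →-dec (e ≟ f))))

    injection⇒∣∣≤ : ∀ {k l} (T : Subset k) (S : Subset l) (φ : ∀ {e} → e ∈ T → Fin l) →
                    (∀ {e} (p : e ∈ T) → φ p ∈ S) →
                    (∀ {e f} (p : e ∈ T) (q : f ∈ T) → φ p ≡ φ q → e ≡ f) →
                    ∣ T ∣ ℕ.≤ ∣ S ∣
    injection⇒∣∣≤ []            S φ φ∈ inj = ℕ.z≤n
    injection⇒∣∣≤ (outside ∷ T) S φ φ∈ inj =
      injection⇒∣∣≤ T S (φ ∘ there) (φ∈ ∘ there)
        (λ p q eq → suc-injective (inj (there p) (there q) eq))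
    injection⇒∣∣≤ (inside ∷ T)  S φ φ∈ inj =
      ℕ.≤-<-trans
        (injection⇒∣∣≤ T (S - φ here) (φ ∘ there)
          (λ p → x∈p∧x≢y⇒x∈p-y (φ∈ (there p))
                   (λ eq → contradiction (inj (there p) here eq) λ ()))
          (λ p q eq → suc-injective (inj (there p) (there q) eq)))
        (x∈p⇒∣p-x∣<∣p∣ (φ∈ here))

    augment : ∀ {S T : Subset #edges} → DistinctSources S → DistinctSources T →
              ∣ S ∣ ℕ.< ∣ T ∣ → ∃[ e ] e ∈ T × e ∉ S × DistinctSources (S ∪ ⁅ e ⁆)
    augment {S} {T} dS dT lt
      with any? (λ e → (e ∈? T) ×-dec ¬? (any? λ f → (f ∈? S) ×-dec (src f ≟ src e)))
    ... | yes (e , e∈T , new) = e , e∈T , (λ e∈S → new (e , e∈S , refl)) , d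
      where
      d : DistinctSources (S ∪ ⁅ e ⁆)
      d x x∈ y y∈ eq with x∈p∪q⁻ S ⁅ e ⁆ x∈ | x∈p∪q⁻ S ⁅ e ⁆ y∈
      ... | inj₁ x∈S | inj₁ y∈S = dS x x∈S y y∈S eq
      ... | inj₁ x∈S | inj₂ y∈e with refl ← x∈⁅y⁆⇒x≡y e y∈e = contradiction (x , x∈S , eq) new
      ... | inj₂ x∈e | inj₁ y∈S with refl ← x∈⁅y⁆⇒x≡y e x∈e = contradiction (y , y∈S , sym eq) new
      ... | inj₂ x∈e | inj₂ y∈e = trans (x∈⁅y⁆⇒x≡y e x∈e) (sym (x∈⁅y⁆⇒x≡y e y∈e))
    ... | no none = contradiction lt (ℕ.≤⇒≯ (injection⇒∣∣≤ T S
            (λ p → proj₁ (partner p)) (λ p → proj₁ (proj₂ (partner p)))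
            (λ {e} {f} p q eq → dT e p f q
              (trans (sym (proj₂ (proj₂ (partner p))))
                (trans (cong src eq) (proj₂ (proj₂ (partner q))))))))
      where
      partner : ∀ {e} → e ∈ T → ∃[ f ] f ∈ S × src f ≡ src e
      partner {e} e∈T = decidable-stable
        (any? λ f → (f ∈? S) ×-dec (src f ≟ src e)) (λ new → none (e , e∈T , new))

  MGS⇔distinctSources : ∀ {S : Subset #edges} → MGS S ⇔ DistinctSources S
  MGS⇔distinctSources = mk⇔ MGS⇒distinct distinct⇒MGS

  ℳ : Matroid #edges
  ℳ = record
    { Independent  = MGS
    ; independent? = MGS?
    ; empty        = distinct⇒MGS (λ _ e∈⊥ → contradiction e∈⊥ ∉⊥)
    ; hereditary   = λ S⊆T mgs → distinct⇒MGS
        (λ e e∈S f f∈S → MGS⇒distinct mgs e (S⊆T e∈S) f (S⊆T f∈S))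
    ; augmentation = λ mS mT lt →
        let e , e∈T , e∉S , d = augment (MGS⇒distinct mS) (MGS⇒distinct mT) lt
        in  e , e∈T , e∉S , distinct⇒MGS d
    }

{-# OPTIONS --safe #-}
-- Since MGS means "distinct sources", the rank of S is the number of distinct
-- sources of edges in S.  Coefficientwise, the chromatic polynomial is then an
-- alternating sum Σ_S (-1)^|S| g(#colours of S) for a colouring of the ground
-- set.  Such a sum only depends on the number q of colours and equals the q-th
-- finite difference of g at 0: toggling an edge whose colour is already used
-- makes all terms cancel, and an edge with a fresh colour contributes one
-- difference.  For g(r) = t^(n-r), each difference is a factor t - 1.
module Submission where

open import Defs
open import Data.Nat.Base using (ℕ)
open import Data.Integer.Base using (1ℤ)

open import Data.Bool.Base using (not)
open import Data.Fin.Base as Fin using (Fin; zero; suc; fromℕ)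
open import Data.Fin.Properties using (≤∧≢⇒<; ≤fromℕ)
open import Data.Fin.Subset
  using (Subset; inside; outside; ⊥; ⊤; _∈_; _∉_; _⊆_; _∪_; ∁; ⁅_⁆; ∣_∣)
open import Data.Fin.Subset.Properties
  using (_∈?_; _⊆?_; x∈p∪q⁻; x∈⁅x⁆; x∈⁅y⁆⇒x≡y; x≢y⇒x∉⁅y⁆; x∈∁p⇒x∉p; x∉p⇒x∈∁p;
         p⊆p∪q; q⊆p∪q; ∪-assoc; ∪-comm; ∪-identityˡ; ∪-identityʳ; ∉⊥; ∈⊤;
         ∣⊥∣≡0; ∣⁅x⁆∣≡1; ∣∁p∣≡n∸∣p∣; ⊆-antisym)
open import Data.Integer.Base as ℤ using (ℤ; 0ℤ; -1ℤ; _+_; _-_; _*_; -_)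
import Data.Integer.Properties as ℤ
open import Data.List.Base using (List; []; _∷_; _++_; map; foldr; replicate)
open import Data.List.Properties using (foldr-preservesᵇ; foldr-preservesᵒ)
open import Data.List.Membership.Propositional using () renaming (_∈_ to _∈ˡ_)
open import Data.List.Membership.Propositional.Properties
  using (∈-map⁺; ∈-++⁺ˡ; ∈-++⁺ʳ; ∈-filter⁺)
import Data.List.Relation.Unary.All as All
open import Data.List.Relation.Unary.All.Properties using (all-filter; map⁺)
open import Data.List.Relation.Unary.Any as Any using (here)
open import Data.Nat.Base as ℕ using (zero; suc; _∸_; _≤_)
import Data.Nat.Properties as ℕ
open import Data.Product.Base using (_×_; _,_; ∃-syntax; proj₁)
open import Data.Sum.Base as Sum using (inj₁; inj₂)
open import Data.Vec.Base using ([]; _∷_; here; there)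
open import Function.Base using (_∘_)
open import Function.Bundles using (Equivalence)
open import Relation.Binary.PropositionalEquality
  using (_≡_; refl; sym; trans; cong; cong₂; subst; module ≡-Reasoning)
open import Relation.Nullary.Decidable using (does; yes; no; _×-dec_)
open import Relation.Nullary.Negation using (contradiction)

open ≡-Reasoning

-- Alternating sums over subsets

-- The sum of (-1)^|S| h(S) over all S, with the signs absorbed into subtraction so that inductions
-- can split on the first element.
altSum : ∀ m → (Subset m → ℤ) → ℤ
altSum zero    h = h []
altSum (suc m) h = altSum m (h ∘ (outside ∷_)) - altSum m (h ∘ (inside ∷_))

altSum-cong : ∀ m {h h′ : Subset m → ℤ} → (∀ S → h S ≡ h′ S) → altSum m h ≡ altSum m h′
altSum-cong zero    eq = eq []
altSum-cong (suc m) eq =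
  cong₂ _-_ (altSum-cong m (eq ∘ (outside ∷_))) (altSum-cong m (eq ∘ (inside ∷_)))

-- Coefficients of sums and products of polynomials.

coeff-+ₚ : ∀ p q k → coeff (p +ₚ q) k ≡ coeff p k + coeff q k
coeff-+ₚ []      q       k       = sym (ℤ.+-identityˡ _)
coeff-+ₚ (a ∷ p) []      k       = sym (ℤ.+-identityʳ _)
coeff-+ₚ (a ∷ p) (b ∷ q) zero    = refl
coeff-+ₚ (a ∷ p) (b ∷ q) (suc k) = coeff-+ₚ p q k

coeff-scale : ∀ a p k → coeff (map (a *_) p) k ≡ a * coeff p k
coeff-scale a []      k       = sym (ℤ.*-zeroʳ a)
coeff-scale a (b ∷ p) zero    = refl
coeff-scale a (b ∷ p) (suc k) = coeff-scale a p k

coeff-0∷[] : ∀ k → coeff (0ℤ ∷ []) k ≡ 0ℤ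
coeff-0∷[] zero    = refl
coeff-0∷[] (suc k) = refl

coeff-const-*ₚ : ∀ a p k → coeff (const a *ₚ p) k ≡ a * coeff p k
coeff-const-*ₚ a p k = begin
  coeff (const a *ₚ p) k                          ≡⟨ coeff-+ₚ (map (a *_) p) _ k ⟩
  coeff (map (a *_) p) k + coeff (0ℤ ∷ []) k      ≡⟨ cong₂ _+_ (coeff-scale a p k) (coeff-0∷[] k) ⟩
  a * coeff p k + 0ℤ                              ≡⟨ ℤ.+-identityʳ _ ⟩
  a * coeff p k                                   ∎

-- Both `t` and `t -ₚ const 1ℤ` have this shape, with `a` equal to 0 and -1; the monic linear term
-- contributes a shift by one place.
coeff-linear-*ₚ : ∀ a p k →
                  coeff ((a ∷ 1ℤ ∷ []) *ₚ p) k ≡ a * coeff p k + coeff (0ℤ ∷ p) k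
coeff-linear-*ₚ a p k =
  trans (coeff-+ₚ (map (a *_) p) _ k) (cong₂ _+_ (coeff-scale a p k) (shift k))
  where
  shift : ∀ k → coeff (0ℤ ∷ (const 1ℤ *ₚ p)) k ≡ coeff (0ℤ ∷ p) k
  shift zero    = refl
  shift (suc k) = trans (coeff-const-*ₚ 1ℤ p k) (ℤ.*-identityˡ _)

-- From list sums to alternating sums.

sumOf : ∀ {A : Set} → (A → ℤ) → List A → ℤ
sumOf f xs = foldr _+_ 0ℤ (map f xs)

sumOf-++ : ∀ {A : Set} (f : A → ℤ) xs ys → sumOf f (xs ++ ys) ≡ sumOf f xs + sumOf f ys
sumOf-++ f []       ys = sym (ℤ.+-identityˡ _)
sumOf-++ f (x ∷ xs) ys =
  trans (cong (f x +_) (sumOf-++ f xs ys)) (sym (ℤ.+-assoc (f x) _ _))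

sumOf-map : ∀ {A B : Set} (f : B → ℤ) (φ : A → B) xs → sumOf f (map φ xs) ≡ sumOf (f ∘ φ) xs
sumOf-map f φ []       = refl
sumOf-map f φ (x ∷ xs) = cong (f (φ x) +_) (sumOf-map f φ xs)

sumOf-cong : ∀ {A : Set} {f f′ : A → ℤ} → (∀ x → f x ≡ f′ x) → ∀ xs → sumOf f xs ≡ sumOf f′ xs
sumOf-cong eq []       = refl
sumOf-cong eq (x ∷ xs) = cong₂ _+_ (eq x) (sumOf-cong eq xs)

sumOf-neg : ∀ {A : Set} (f : A → ℤ) xs → sumOf (-_ ∘ f) xs ≡ - sumOf f xs
sumOf-neg f []       = refl
sumOf-neg f (x ∷ xs) =
  trans (cong (- f x +_) (sumOf-neg f xs)) (sym (ℤ.neg-distrib-+ (f x) _))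

coeff-sumₚ : ∀ {A : Set} (f : A → Poly) xs k →
             coeff (sumₚ (map f xs)) k ≡ sumOf (λ x → coeff (f x) k) xs
coeff-sumₚ f []       k = refl
coeff-sumₚ f (x ∷ xs) k =
  trans (coeff-+ₚ (f x) _ k) (cong (coeff (f x) k +_) (coeff-sumₚ f xs k))

-- Putting the first element inside raises `∣ S ∣` by one; the extra factor `-1ℤ` becomes the
-- subtraction in `altSum`.
sumOf-subsets : ∀ m (h : Subset m → ℤ) →
                sumOf (λ S → -1ℤ ℤ.^ ∣ S ∣ * h S) (subsets m) ≡ altSum m h
sumOf-subsets zero    h = trans (ℤ.+-identityʳ _) (ℤ.*-identityˡ _)
sumOf-subsets (suc m) h = begin
  sumOf f (map (outside ∷_) (subsets m) ++ map (inside ∷_) (subsets m))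
    ≡⟨ sumOf-++ f (map (outside ∷_) (subsets m)) _ ⟩
  sumOf f (map (outside ∷_) (subsets m)) + sumOf f (map (inside ∷_) (subsets m))
    ≡⟨ cong₂ _+_ (sumOf-map f _ (subsets m)) (sumOf-map f _ (subsets m)) ⟩
  sumOf (f ∘ (outside ∷_)) (subsets m) + sumOf (f ∘ (inside ∷_)) (subsets m)
    ≡⟨ cong₂ _+_ (sumOf-subsets m _) inside-half ⟩
  altSum (suc m) h ∎
  where
  f : Subset (suc m) → ℤ
  f S = -1ℤ ℤ.^ ∣ S ∣ * h S
  sign : ∀ x y → -1ℤ * x * y ≡ - (x * y)
  sign x y = trans (ℤ.*-assoc -1ℤ x y) (ℤ.-1*i≡-i (x * y))
  inside-half : sumOf (f ∘ (inside ∷_)) (subsets m) ≡ - altSum m (h ∘ (inside ∷_))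
  inside-half = begin
    sumOf (f ∘ (inside ∷_)) (subsets m)
      ≡⟨ sumOf-cong (λ S → sign (-1ℤ ℤ.^ ∣ S ∣) (h (inside ∷ S))) (subsets m) ⟩
    sumOf (λ S → - (-1ℤ ℤ.^ ∣ S ∣ * h (inside ∷ S))) (subsets m)
      ≡⟨ sumOf-neg _ (subsets m) ⟩
    - sumOf (λ S → -1ℤ ℤ.^ ∣ S ∣ * h (inside ∷ S)) (subsets m)
      ≡⟨ cong -_ (sumOf-subsets m _) ⟩
    - altSum m (h ∘ (inside ∷_)) ∎

coeff-chromaticPolynomial :
  ∀ {m} (M : Matroid m) k →
  coeff (chromaticPolynomial M) k ≡ altSum m (λ S → coeff (t ^ₚ (rank M ⊤ ∸ rank M S)) k)
coeff-chromaticPolynomial {m} M k = begin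
  coeff (chromaticPolynomial M) k
    ≡⟨ coeff-sumₚ (λ S → const (-1ℤ ℤ.^ ∣ S ∣) *ₚ P S) (subsets m) k ⟩
  sumOf (λ S → coeff (const (-1ℤ ℤ.^ ∣ S ∣) *ₚ P S) k) (subsets m)
    ≡⟨ sumOf-cong (λ S → coeff-const-*ₚ (-1ℤ ℤ.^ ∣ S ∣) (P S) k) (subsets m) ⟩
  sumOf (λ S → -1ℤ ℤ.^ ∣ S ∣ * coeff (P S) k) (subsets m)
    ≡⟨ sumOf-subsets m _ ⟩
  altSum m (λ S → coeff (P S) k) ∎
  where
  P : Subset m → Poly
  P S = t ^ₚ (rank M ⊤ ∸ rank M S)

-- Colourings of a finite set

insert-∈ : ∀ {K} {a : Fin K} {p} → a ∈ p → p ∪ ⁅ a ⁆ ≡ p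
insert-∈ {p = inside ∷ p} here        = cong (inside ∷_) (∪-identityʳ p)
insert-∈ {p = inside ∷ p} (there a∈p) = cong (inside ∷_) (insert-∈ a∈p)
insert-∈ {p = outside ∷ p} (there a∈p) = cong (outside ∷_) (insert-∈ a∈p)

∣insert-∉∣ : ∀ {K} {a : Fin K} {p} → a ∉ p → ∣ p ∪ ⁅ a ⁆ ∣ ≡ suc ∣ p ∣
∣insert-∉∣ {a = zero}  {inside ∷ p}  a∉p = contradiction here a∉p
∣insert-∉∣ {a = zero}  {outside ∷ p} a∉p = cong (suc ∘ ∣_∣) (∪-identityʳ p)
∣insert-∉∣ {a = suc a} {inside ∷ p}  a∉p = cong suc (∣insert-∉∣ (a∉p ∘ there))
∣insert-∉∣ {a = suc a} {outside ∷ p} a∉p = ∣insert-∉∣ (a∉p ∘ there)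

-- Moves the colour of the first element from the image into the set `U` of colours already used,
-- the form in which induction hypotheses apply.
∪-insert : ∀ {K} (U p : Subset K) a → U ∪ (p ∪ ⁅ a ⁆) ≡ (U ∪ ⁅ a ⁆) ∪ p
∪-insert U p a = trans (cong (U ∪_) (∪-comm p ⁅ a ⁆)) (sym (∪-assoc U ⁅ a ⁆ p))

image : ∀ {m K} → (Fin m → Fin K) → Subset m → Subset K
image c []            = ⊥
image c (outside ∷ S) = image (c ∘ suc) S
image c (inside ∷ S)  = image (c ∘ suc) S ∪ ⁅ c zero ⁆

∈-image⁺ : ∀ {m K} (c : Fin m → Fin K) {S e} → e ∈ S → c e ∈ image c S
∈-image⁺ c {inside ∷ S}  here        = q⊆p∪q (image (c ∘ suc) S) _ (x∈⁅x⁆ (c zero))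
∈-image⁺ c {inside ∷ S}  (there e∈S) = p⊆p∪q _ (∈-image⁺ (c ∘ suc) e∈S)
∈-image⁺ c {outside ∷ S} (there e∈S) = ∈-image⁺ (c ∘ suc) e∈S

-- The last element of S in each colour.
reps : ∀ {m K} → (Fin m → Fin K) → Subset m → Subset m
reps c []            = []
reps c (outside ∷ S) = outside ∷ reps (c ∘ suc) S
reps c (inside ∷ S)  = not (does (c zero ∈? image (c ∘ suc) S)) ∷ reps (c ∘ suc) S

reps⊆ : ∀ {m K} (c : Fin m → Fin K) S → reps c S ⊆ S
reps⊆ c (outside ∷ S) (there x∈) = there (reps⊆ (c ∘ suc) S x∈)
reps⊆ c (inside ∷ S)  {zero}  _          = here
reps⊆ c (inside ∷ S)  {suc x} (there x∈) = there (reps⊆ (c ∘ suc) S x∈)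

∣reps∣ : ∀ {m K} (c : Fin m → Fin K) S → ∣ reps c S ∣ ≡ ∣ image c S ∣
∣reps∣ {K = K} c []  = sym (∣⊥∣≡0 K)
∣reps∣ c (outside ∷ S) = ∣reps∣ (c ∘ suc) S
∣reps∣ c (inside ∷ S) with c zero ∈? image (c ∘ suc) S
... | yes a∈ = trans (∣reps∣ (c ∘ suc) S) (cong ∣_∣ (sym (insert-∈ a∈)))
... | no  a∉ = trans (cong suc (∣reps∣ (c ∘ suc) S)) (sym (∣insert-∉∣ a∉))

-- The preimage is found among the representatives, not merely in `S`; this is what makes `reps` a
-- maximal independent set below.
∈-image⁻ : ∀ {m K} (c : Fin m → Fin K) S {i} → i ∈ image c S → ∃[ f ] f ∈ reps c S × c f ≡ i
∈-image⁻ c []            i∈ = contradiction i∈ ∉⊥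
∈-image⁻ c (outside ∷ S) i∈ with f , f∈ , eq ← ∈-image⁻ (c ∘ suc) S i∈ = suc f , there f∈ , eq
∈-image⁻ c (inside ∷ S)  {i} i∈ with c zero ∈? image (c ∘ suc) S
... | yes a∈ with f , f∈ , eq ← ∈-image⁻ (c ∘ suc) S (subst (i ∈_) (insert-∈ a∈) i∈) =
  suc f , there f∈ , eq
... | no a∉ with x∈p∪q⁻ (image (c ∘ suc) S) _ i∈
...   | inj₁ i∈′ with f , f∈ , eq ← ∈-image⁻ (c ∘ suc) S i∈′ = suc f , there f∈ , eq
...   | inj₂ i∈a = zero , here , sym (x∈⁅y⁆⇒x≡y (c zero) i∈a)

reps-injective : ∀ {m K} (c : Fin m → Fin K) S {e f} →
                 e ∈ reps c S → f ∈ reps c S → c e ≡ c f → e ≡ f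
reps-injective c (outside ∷ S) (there e∈) (there f∈) eq =
  cong suc (reps-injective (c ∘ suc) S e∈ f∈ eq)
reps-injective c (inside ∷ S) e∈ f∈ eq with c zero ∈? image (c ∘ suc) S | e∈ | f∈
... | yes _ | there e∈′ | there f∈′ = cong suc (reps-injective (c ∘ suc) S e∈′ f∈′ eq)
... | no _  | there e∈′ | there f∈′ = cong suc (reps-injective (c ∘ suc) S e∈′ f∈′ eq)
... | no _  | here      | here      = refl
-- A retained first element has a colour absent from the rest of `S`, so the mixed cases are
-- contradictory.
... | no a∉ | here      | there f∈′ =
  contradiction (subst (_∈ image (c ∘ suc) S) (sym eq)
    (∈-image⁺ (c ∘ suc) (reps⊆ (c ∘ suc) S f∈′))) a∉
... | no a∉ | there e∈′ | here      =
  contradiction (subst (_∈ image (c ∘ suc) S) eq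
    (∈-image⁺ (c ∘ suc) (reps⊆ (c ∘ suc) S e∈′))) a∉

-- Alternating sums over a coloured set

-- Up to the sign (-1)^q this is the usual forward difference: it equals the sum of (-1)^i C(q,i)
-- g(r+i).
Δ^ : ℕ → (ℕ → ℤ) → ℕ → ℤ
Δ^ zero    g r = g r
Δ^ (suc q) g r = Δ^ q g r - Δ^ q g (suc r)

-- Toggling `e` does not change the union, so the terms cancel in pairs. Elements before `e` only
-- enlarge `U`, so both halves of the sum vanish by induction.
altSum-image-vanishes :
  ∀ {m K} (c : Fin m → Fin K) (g : ℕ → ℤ) U {e} → c e ∈ U →
  altSum m (λ S → g ∣ U ∪ image c S ∣) ≡ 0ℤ
altSum-image-vanishes {suc m} c g U {zero} a∈U =
  trans (cong (λ x → Out - x) (altSum-cong m λ S → cong (g ∘ ∣_∣) (begin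
    U ∪ (image (c ∘ suc) S ∪ ⁅ c zero ⁆) ≡⟨ ∪-insert U _ (c zero) ⟩
    (U ∪ ⁅ c zero ⁆) ∪ image (c ∘ suc) S ≡⟨ cong (_∪ image (c ∘ suc) S) (insert-∈ a∈U) ⟩
    U ∪ image (c ∘ suc) S                ∎)))
  (ℤ.+-inverseʳ Out)
  where
  Out = altSum m (λ S → g ∣ U ∪ image (c ∘ suc) S ∣)
altSum-image-vanishes {suc m} c g U {suc e} e∈U = cong₂ _-_
  (altSum-image-vanishes (c ∘ suc) g U e∈U)
  (trans (altSum-cong m (λ S → cong (g ∘ ∣_∣) (∪-insert U _ (c zero))))
         (altSum-image-vanishes (c ∘ suc) g (U ∪ ⁅ c zero ⁆) (p⊆p∪q _ e∈U)))

-- Induction on the first element, with `U` collecting the colours used so far. Its colour counts as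
-- new only if no later element shares it.
altSum-image :
  ∀ {m K} (c : Fin m → Fin K) (g : ℕ → ℤ) U → (∀ e → c e ∉ U) →
  altSum m (λ S → g ∣ U ∪ image c S ∣) ≡ Δ^ (∣ image c ⊤ ∣) g (∣ U ∣)
altSum-image {zero} {K} c g U c∉U = begin
  g ∣ U ∪ ⊥ ∣                    ≡⟨ cong (g ∘ ∣_∣) (∪-identityʳ U) ⟩
  g ∣ U ∣                        ≡⟨ cong (λ q → Δ^ q g ∣ U ∣) (∣⊥∣≡0 K) ⟨
  Δ^ (∣ ⊥ {n = K} ∣) g (∣ U ∣)   ∎
altSum-image {suc m} {K} c g U c∉U = begin
  Out - altSum m (λ S → g ∣ U ∪ (image c′ S ∪ ⁅ a ⁆) ∣)
    ≡⟨ cong (λ x → Out - x) (altSum-cong m λ S → cong (g ∘ ∣_∣) (∪-insert U (image c′ S) a)) ⟩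
  Out - In
    ≡⟨ cong (_- In) (altSum-image c′ g U (c∉U ∘ suc)) ⟩
  Δ^ (∣ image c′ ⊤ ∣) g (∣ U ∣) - In
    ≡⟨ combine ⟩
  Δ^ (∣ image c′ ⊤ ∪ ⁅ a ⁆ ∣) g (∣ U ∣) ∎
  where
  a : Fin K
  a = c zero
  c′ : Fin m → Fin K
  c′ = c ∘ suc
  Out In : ℤ
  Out = altSum m (λ S → g ∣ U ∪ image c′ S ∣)
  In  = altSum m (λ S → g ∣ (U ∪ ⁅ a ⁆) ∪ image c′ S ∣)
  combine : Δ^ (∣ image c′ ⊤ ∣) g (∣ U ∣) - In ≡ Δ^ (∣ image c′ ⊤ ∪ ⁅ a ⁆ ∣) g (∣ U ∣)
  combine with a ∈? image c′ ⊤
  -- A later element `e` has colour `a`, which is already in `U ∪ ⁅ a ⁆`, so `In` vanishes; the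
  -- number of colours stays the same.
  ... | yes a∈ with e , _ , eq ← ∈-image⁻ c′ ⊤ a∈ = begin
    D - In   ≡⟨ cong (λ x → D - x) (altSum-image-vanishes c′ g (U ∪ ⁅ a ⁆)
                  (subst (_∈ U ∪ ⁅ a ⁆) (sym eq) (q⊆p∪q U _ (x∈⁅x⁆ a)))) ⟩
    D - 0ℤ   ≡⟨ ℤ.+-identityʳ D ⟩
    D        ≡⟨ cong (λ p → Δ^ (∣ p ∣) g (∣ U ∣)) (insert-∈ a∈) ⟨
    Δ^ (∣ image c′ ⊤ ∪ ⁅ a ⁆ ∣) g (∣ U ∣) ∎
    where D = Δ^ (∣ image c′ ⊤ ∣) g (∣ U ∣)
  -- No later colour equals `a`, so the induction hypothesis applies to `U ∪ ⁅ a ⁆`; its argument is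
  -- one larger, which gives one more difference.
  ... | no a∉ = begin
    D - In
      ≡⟨ cong (λ x → D - x) (altSum-image c′ g (U ∪ ⁅ a ⁆) c∉U∪a) ⟩
    D - Δ^ (∣ image c′ ⊤ ∣) g (∣ U ∪ ⁅ a ⁆ ∣)
      ≡⟨ cong (λ r → D - Δ^ (∣ image c′ ⊤ ∣) g r) (∣insert-∉∣ (c∉U zero)) ⟩
    Δ^ (suc ∣ image c′ ⊤ ∣) g (∣ U ∣)
      ≡⟨ cong (λ q → Δ^ q g ∣ U ∣) (∣insert-∉∣ a∉) ⟨
    Δ^ (∣ image c′ ⊤ ∪ ⁅ a ⁆ ∣) g (∣ U ∣) ∎
    where
    D = Δ^ (∣ image c′ ⊤ ∣) g (∣ U ∣)
    c∉U∪a : ∀ e → c′ e ∉ U ∪ ⁅ a ⁆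
    c∉U∪a e e∈ with x∈p∪q⁻ U _ e∈
    ... | inj₁ e∈U = c∉U (suc e) e∈U
    ... | inj₂ e∈a = a∉ (subst (_∈ image c′ ⊤) (x∈⁅y⁆⇒x≡y a e∈a) (∈-image⁺ c′ ∈⊤))

-- Differences of powers of t; the list replicate j 0ℤ ++ p represents t^j p.

coeff-t^ : ∀ j k → coeff (t ^ₚ j) k ≡ coeff (replicate j 0ℤ ++ const 1ℤ) k
coeff-t^ zero    k = refl
coeff-t^ (suc j) k =
  trans (coeff-linear-*ₚ 0ℤ (t ^ₚ j) k)
    (trans (cong (_+ coeff (0ℤ ∷ t ^ₚ j) k) (ℤ.*-zeroˡ (coeff (t ^ₚ j) k)))
      (trans (ℤ.+-identityˡ _) (shift k)))
  where
  shift : ∀ k → coeff (0ℤ ∷ t ^ₚ j) k ≡ coeff (replicate (suc j) 0ℤ ++ const 1ℤ) k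
  shift zero    = refl
  shift (suc k) = coeff-t^ j k

coeff-t^-*-[t-1] :
  ∀ j p k → coeff (replicate (suc j) 0ℤ ++ p) k - coeff (replicate j 0ℤ ++ p) k ≡
            coeff (replicate j 0ℤ ++ (t -ₚ const 1ℤ) *ₚ p) k
coeff-t^-*-[t-1] zero    p k       = begin
  coeff (0ℤ ∷ p) k - coeff p k          ≡⟨ ℤ.+-comm (coeff (0ℤ ∷ p) k) _ ⟩
  - coeff p k + coeff (0ℤ ∷ p) k        ≡⟨ cong (_+ coeff (0ℤ ∷ p) k) (ℤ.-1*i≡-i (coeff p k)) ⟨
  -1ℤ * coeff p k + coeff (0ℤ ∷ p) k    ≡⟨ coeff-linear-*ₚ -1ℤ p k ⟨
  coeff ((t -ₚ const 1ℤ) *ₚ p) k        ∎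
coeff-t^-*-[t-1] (suc j) p zero    = refl
coeff-t^-*-[t-1] (suc j) p (suc k) = coeff-t^-*-[t-1] j p k

-- The result is t^j (t-1)^q. The total r + q + j is kept fixed in the induction: of the two terms
-- of a difference, one trades a unit of `q` for `j`, the other for `r`.
Δ^-t^ : ∀ q r j k →
        Δ^ q (λ i → coeff (t ^ₚ (r ℕ.+ (q ℕ.+ j) ∸ i)) k) r ≡
        coeff (replicate j 0ℤ ++ (t -ₚ const 1ℤ) ^ₚ q) k
Δ^-t^ zero    r j k = trans (cong (λ i → coeff (t ^ₚ i) k) (ℕ.m+n∸m≡n r j)) (coeff-t^ j k)
Δ^-t^ (suc q) r j k = trans
  (cong₂ _-_
    (trans (cong (λ N → Δ^ q (G N) r) (cong (r ℕ.+_) (sym (ℕ.+-suc q j)))) (Δ^-t^ q r (suc j) k))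
    (trans (cong (λ N → Δ^ q (G N) (suc r)) (ℕ.+-suc r (q ℕ.+ j))) (Δ^-t^ q (suc r) j k)))
  (coeff-t^-*-[t-1] j ((t -ₚ const 1ℤ) ^ₚ q) k)
  where
  G : ℕ → ℕ → ℤ
  G N i = coeff (t ^ₚ (N ∸ i)) k

-- Ranks

∈-subsets : ∀ {m} (S : Subset m) → S ∈ˡ subsets m
∈-subsets []            = here refl
∈-subsets (outside ∷ S) = ∈-++⁺ˡ (∈-map⁺ (outside ∷_) (∈-subsets S))
∈-subsets (inside ∷ S)  = ∈-++⁺ʳ (map (outside ∷_) (subsets _)) (∈-map⁺ (inside ∷_) (∈-subsets S))

module _ {m : ℕ} (M : Matroid m) where
  open Matroid M

  -- A larger independent subset of `S` would augment `B` by some `e ∉ B`, against maximality;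
  -- conversely `B` itself occurs in the list whose maximum is taken.
  rank-basis : ∀ {S B} → B ⊆ S → Independent B →
               (∀ {e} → e ∈ S → Independent (B ∪ ⁅ e ⁆) → e ∈ B) →
               rank M S ≡ ∣ B ∣
  rank-basis {S} {B} B⊆S indB maximal = ℕ.≤-antisym
    (foldr-preservesᵇ {P = _≤ ∣ B ∣} ℕ.⊔-lub ℕ.z≤n
      (map⁺ (All.map bound (all-filter indep⊆S? (subsets m)))))
    (foldr-preservesᵒ {P = ∣ B ∣ ≤_} (λ x y → Sum.[ ℕ.m≤n⇒m≤n⊔o y , ℕ.m≤n⇒m≤o⊔n x ]) 0 _
      (inj₂ (Any.map ℕ.≤-reflexive
        (∈-map⁺ ∣_∣ (∈-filter⁺ indep⊆S? (∈-subsets B) (B⊆S , indB))))))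
    where
    indep⊆S? = λ T → (T ⊆? S) ×-dec independent? T
    bound : ∀ {T} → T ⊆ S × Independent T → ∣ T ∣ ≤ ∣ B ∣
    bound (T⊆S , indT) = ℕ.≮⇒≥ λ lt →
      let e , e∈T , e∉B , ind = augmentation indB indT lt
      in  e∉B (maximal (T⊆S e∈T) ind)

-- The representatives form a basis of `S`: if `e` can be added to them independently, it shares its
-- source with some representative `f`, and distinctness of sources forces `f` and `e` to coincide.
rank-ℳ : ∀ n S → rank (ℳ n) S ≡ ∣ image (src n) S ∣
rank-ℳ n S = trans
  (rank-basis (ℳ n) (reps⊆ (src n) S)
    (from (λ e e∈ f f∈ → reps-injective (src n) S e∈ f∈))
    maximal)
  (∣reps∣ (src n) S)
  where
  open module MGS⇔ {T} = Equivalence (MGS⇔distinctSources n {T})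
  B = reps (src n) S
  maximal : ∀ {e} → e ∈ S → MGS n (B ∪ ⁅ e ⁆) → e ∈ B
  maximal {e} e∈S mgs with f , f∈B , eq ← ∈-image⁻ (src n) S (∈-image⁺ (src n) e∈S) =
    subst (_∈ B) (to mgs f (p⊆p∪q _ f∈B) e (q⊆p∪q B _ (x∈⁅x⁆ e)) eq) f∈B

-- No edge leaves the top vertex, while every other vertex is the source of an edge to the top.
image-src-⊤ : ∀ n → image (src n) ⊤ ≡ ∁ ⁅ fromℕ n ⁆
image-src-⊤ n = ⊆-antisym ⇒ ⇐
  where
  ⇒ : image (src n) ⊤ ⊆ ∁ ⁅ fromℕ n ⁆
  ⇒ i∈ with e , _ , refl ← ∈-image⁻ (src n) ⊤ i∈ =
    x∉p⇒x∈∁p (x≢y⇒x∉⁅y⁆ λ eq → ℕ.<⇒≱ (src<tgt n e)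
      (subst (λ i → tgt n e Fin.≤ i) (sym eq) (≤fromℕ (tgt n e))))
  ⇐ : ∁ ⁅ fromℕ n ⁆ ⊆ image (src n) ⊤
  ⇐ {i} i∈ with e , eq ← edge-surjective n {i} {fromℕ n}
    (≤∧≢⇒< (≤fromℕ i) λ { refl → x∈∁p⇒x∉p i∈ (x∈⁅x⁆ (fromℕ n)) }) =
    subst (_∈ image (src n) ⊤) (cong proj₁ eq) (∈-image⁺ (src n) ∈⊤)

∣image-src-⊤∣ : ∀ n → ∣ image (src n) ⊤ ∣ ≡ n
∣image-src-⊤∣ n = begin
  ∣ image (src n) ⊤ ∣       ≡⟨ cong ∣_∣ (image-src-⊤ n) ⟩
  ∣ ∁ ⁅ fromℕ n ⁆ ∣         ≡⟨ ∣∁p∣≡n∸∣p∣ ⁅ fromℕ n ⁆ ⟩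
  suc n ∸ ∣ ⁅ fromℕ n ⁆ ∣   ≡⟨ cong (suc n ∸_) (∣⁅x⁆∣≡1 (fromℕ n)) ⟩
  n                         ∎

corollary3p4 : ∀ (n : ℕ) → chromaticPolynomial (ℳ n) ≈ₚ (t -ₚ const 1ℤ) ^ₚ n
corollary3p4 n k = begin
  coeff (chromaticPolynomial (ℳ n)) k
    ≡⟨ coeff-chromaticPolynomial (ℳ n) k ⟩
  altSum m (λ S → coeff (t ^ₚ (rank (ℳ n) ⊤ ∸ rank (ℳ n) S)) k)
    -- The empty set of used colours is inserted to start the induction of `altSum-image`.
    ≡⟨ altSum-cong m (λ S → cong₂ (λ r s → coeff (t ^ₚ (r ∸ s)) k)
         (trans (rank-ℳ n ⊤) (∣image-src-⊤∣ n))
         (trans (rank-ℳ n S) (cong ∣_∣ (sym (∪-identityˡ (image (src n) S)))))) ⟩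
  altSum m (λ S → g ∣ ⊥ ∪ image (src n) S ∣)
    ≡⟨ altSum-image (src n) g ⊥ (λ _ → ∉⊥) ⟩
  Δ^ (∣ image (src n) ⊤ ∣) g ∣ ⊥ {n = suc n} ∣
    ≡⟨ cong₂ (λ q r → Δ^ q g r) (∣image-src-⊤∣ n) (∣⊥∣≡0 (suc n)) ⟩
  Δ^ n g 0
    -- Rewriting `n` as `n + 0` matches `Δ^-t^` with `r` and `j` both zero.
    ≡⟨ cong (λ N → Δ^ n (λ r → coeff (t ^ₚ (N ∸ r)) k) 0) (ℕ.+-identityʳ n) ⟨
  Δ^ n (λ r → coeff (t ^ₚ (n ℕ.+ 0 ∸ r)) k) 0
    ≡⟨ Δ^-t^ n 0 0 k ⟩
  coeff ((t -ₚ const 1ℤ) ^ₚ n) k ∎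
  where
  m = #edges n
  g : ℕ → ℤ
  g r = coeff (t ^ₚ (n ∸ r)) k
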